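{- (i) The theory $\mathsf{Seq}$ is a sequential theory, i.e. $\mathsf{Seq}$ directly interprets the adjunctive set theory $\mathsf{AST}$. (ii) $\mathsf{Seq}$ is essentially undecidable.
   Context: $\mathsf{Seq}$ is the first-order theory in the language $\{e,\ \vdash,\ \circ\}$, where $e$ is a constant symbol and $\vdash$ and $\circ$ are binary function symbols (here $x\vdash y$ is a term-forming operation, not provability; $x\circ y$ is also written $xy$). Its non-logical axioms are: $\mathsf{Seq}_1$: $\forall x y\, [x\vdash y\neq e]$; $\mathsf{Seq}_2$: $\forall x_1x_2y_1y_2\,[x_1\vdash x_2=y_1\vdash y_2\rightarrow (x_1=y_1\wedge x_2=y_2)]$; $\mathsf{Seq}_3$: $\forall x\,[x\circ e=x]$; $\mathsf{Seq}_4$: $\forall xyz\,[x\circ(y\vdash z)=(x\circ y)\vdash z]$; $\mathsf{Seq}_5$: $\forall x\,[x=e\vee\exists yz\,[x=y\vdash z]]$. $\mathsf{AST}$ is the theory in the language $\{\in\}$ with axioms $\exists y\forall x\,[x\notin y]$ (empty set) and $\forall xy\exists z\forall u\,[u\in z\leftrightarrow(u\in x\vee u=y)]$ (adjunction). A theory is called sequential if it directly interprets $\mathsf{AST}$ (an interpretation with unrelativized domain, translating equality as equality). A theory is essentially undecidable if every consistent extension of it is undecidable. -}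

module Defs where

open import Data.Nat using (ℕ; zero; suc; _+_; _*_; _^_; _<_)
open import Data.Fin using (Fin; toℕ; #_) renaming (zero to fz; suc to fs)
open import Data.Vec using (Vec; []; _∷_; lookup)
open import Data.List using (List; map) renaming ([] to ε; _∷_ to _,,_)
open import Data.List.Membership.Propositional using (_∈_)
open import Data.Product using (Σ; _×_; _,_)
open import Data.Empty using (⊥)
open import Relation.Nullary using (¬_)
open import Relation.Nullary.Decidable using (True)
open import Data.Nat using (_<?_)
open import Relation.Binary.PropositionalEquality using (_≡_)

record Sig : Set₁ where
  field
    Fun    : Set
    fArity : Fun → ℕ
    Rel    : Set
    rArity : Rel → ℕ
open Sig public

data Term (L : Sig) (n : ℕ) : Set where
  var : Fin n → Term L n
  app : (f : Fun L) → Vec (Term L n) (fArity L f) → Term L n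

data Formula (L : Sig) : ℕ → Set where
  ⊥'   : ∀ {n} → Formula L n
  rel  : ∀ {n} (r : Rel L) → Vec (Term L n) (rArity L r) → Formula L n
  _≐_  : ∀ {n} → Term L n → Term L n → Formula L n
  _⇒_  : ∀ {n} → Formula L n → Formula L n → Formula L n
  ∀'   : ∀ {n} → Formula L (suc n) → Formula L n

infix  6 _≐_
infixr 4 _⇒_

module _ {L : Sig} where

  ¬'_ : ∀ {n} → Formula L n → Formula L n
  ¬' φ = φ ⇒ ⊥'

  _∨'_ : ∀ {n} → Formula L n → Formula L n → Formula L n
  φ ∨' ψ = (¬' φ) ⇒ ψ

  _∧'_ : ∀ {n} → Formula L n → Formula L n → Formula L n
  φ ∧' ψ = ¬' (φ ⇒ ¬' ψ)

  _⇔_ : ∀ {n} → Formula L n → Formula L n → Formula L n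
  φ ⇔ ψ = (φ ⇒ ψ) ∧' (ψ ⇒ φ)

  ∃' : ∀ {n} → Formula L (suc n) → Formula L n
  ∃' φ = ¬' (∀' (¬' φ))

  renT  : ∀ {n m} → (Fin n → Fin m) → Term L n → Term L m
  renTs : ∀ {n m k} → (Fin n → Fin m) → Vec (Term L n) k → Vec (Term L m) k
  renT ρ (var i)    = var (ρ i)
  renT ρ (app f ts) = app f (renTs ρ ts)
  renTs ρ []       = []
  renTs ρ (t ∷ ts) = renT ρ t ∷ renTs ρ ts

  liftR : ∀ {n m} → (Fin n → Fin m) → Fin (suc n) → Fin (suc m)
  liftR ρ fz     = fz
  liftR ρ (fs i) = fs (ρ i)

  renF : ∀ {n m} → (Fin n → Fin m) → Formula L n → Formula L m
  renF ρ ⊥'         = ⊥'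
  renF ρ (rel r ts) = rel r (renTs ρ ts)
  renF ρ (s ≐ t)    = renT ρ s ≐ renT ρ t
  renF ρ (φ ⇒ ψ)    = renF ρ φ ⇒ renF ρ ψ
  renF ρ (∀' φ)     = ∀' (renF (liftR ρ) φ)

  subT  : ∀ {n m} → (Fin n → Term L m) → Term L n → Term L m
  subTs : ∀ {n m k} → (Fin n → Term L m) → Vec (Term L n) k → Vec (Term L m) k
  subT σ (var i)    = σ i
  subT σ (app f ts) = app f (subTs σ ts)
  subTs σ []       = []
  subTs σ (t ∷ ts) = subT σ t ∷ subTs σ ts

  liftS : ∀ {n m} → (Fin n → Term L m) → Fin (suc n) → Term L (suc m)
  liftS σ fz     = var fz
  liftS σ (fs i) = renT fs (σ i)

  subF : ∀ {n m} → (Fin n → Term L m) → Formula L n → Formula L m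
  subF σ ⊥'         = ⊥'
  subF σ (rel r ts) = rel r (subTs σ ts)
  subF σ (s ≐ t)    = subT σ s ≐ subT σ t
  subF σ (φ ⇒ ψ)    = subF σ φ ⇒ subF σ ψ
  subF σ (∀' φ)     = ∀' (subF (liftS σ) φ)

  sub0 : ∀ {n} → Term L n → Fin (suc n) → Term L n
  sub0 t fz     = t
  sub0 t (fs i) = var i

  _[_] : ∀ {n} → Formula L (suc n) → Term L n → Formula L n
  φ [ t ] = subF (sub0 t) φ

  wkSentence : ∀ {n} → Formula L 0 → Formula L n
  wkSentence = renF (λ ())

data _⨾_⊢_ {L : Sig} (T : Formula L 0 → Set) :
           {n : ℕ} → List (Formula L n) → Formula L n → Set where
  axiom : ∀ {n} {Γ : List (Formula L n)} {ψ} → T ψ → T ⨾ Γ ⊢ wkSentence ψ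
  hyp   : ∀ {n} {Γ : List (Formula L n)} {φ} → φ ∈ Γ → T ⨾ Γ ⊢ φ
  ⇒I    : ∀ {n} {Γ : List (Formula L n)} {φ ψ} → T ⨾ (φ ,, Γ) ⊢ ψ → T ⨾ Γ ⊢ (φ ⇒ ψ)
  ⇒E    : ∀ {n} {Γ : List (Formula L n)} {φ ψ} → T ⨾ Γ ⊢ (φ ⇒ ψ) → T ⨾ Γ ⊢ φ → T ⨾ Γ ⊢ ψ
  raa   : ∀ {n} {Γ : List (Formula L n)} {φ} → T ⨾ ((¬' φ) ,, Γ) ⊢ ⊥' → T ⨾ Γ ⊢ φ
  ∀I    : ∀ {n} {Γ : List (Formula L n)} {φ} → T ⨾ map (renF fs) Γ ⊢ φ → T ⨾ Γ ⊢ ∀' φ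
  ∀E    : ∀ {n} {Γ : List (Formula L n)} {φ} → T ⨾ Γ ⊢ ∀' φ → (t : Term L n) → T ⨾ Γ ⊢ (φ [ t ])
  ≐refl : ∀ {n} {Γ : List (Formula L n)} (t : Term L n) → T ⨾ Γ ⊢ (t ≐ t)
  ≐subst : ∀ {n} {Γ : List (Formula L n)} {s t : Term L n} (φ : Formula L (suc n)) →
           T ⨾ Γ ⊢ (s ≐ t) → T ⨾ Γ ⊢ (φ [ s ]) → T ⨾ Γ ⊢ (φ [ t ])

_⊢_ : {L : Sig} → (Formula L 0 → Set) → Formula L 0 → Set
T ⊢ φ = T ⨾ ε ⊢ φ

data SeqFun : Set where
  e tu circ : SeqFun

seqArity : SeqFun → ℕ
seqArity e    = 0
seqArity tu   = 2
seqArity circ = 2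

data NoRel : Set where

SeqL : Sig
SeqL = record { Fun = SeqFun ; fArity = seqArity ; Rel = NoRel ; rArity = λ () }

module _ {n : ℕ} where
  infixl 9 _∘T_
  infixl 8 _⊢T_

  eT : Term SeqL n
  eT = app e []

  _⊢T_ : Term SeqL n → Term SeqL n → Term SeqL n
  x ⊢T y = app tu (x ∷ y ∷ [])

  _∘T_ : Term SeqL n → Term SeqL n → Term SeqL n
  x ∘T y = app circ (x ∷ y ∷ [])

v : ∀ {n} (i : ℕ) → {i<n : True (i <? n)} → Term SeqL n
v i {p} = var (#_ i {m<n = p})

Seq1 : Formula SeqL 0
Seq1 = ∀' (∀' (¬' (v 1 ⊢T v 0 ≐ eT)))

Seq2 : Formula SeqL 0
Seq2 = ∀' (∀' (∀' (∀' ((v 3 ⊢T v 2 ≐ v 1 ⊢T v 0) ⇒ ((v 3 ≐ v 1) ∧' (v 2 ≐ v 0))))))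

Seq3 : Formula SeqL 0
Seq3 = ∀' (v 0 ∘T eT ≐ v 0)

Seq4 : Formula SeqL 0
Seq4 = ∀' (∀' (∀' (v 2 ∘T (v 1 ⊢T v 0) ≐ (v 2 ∘T v 1) ⊢T v 0)))

Seq5 : Formula SeqL 0
Seq5 = ∀' ((v 0 ≐ eT) ∨' ∃' (∃' (v 2 ≐ v 1 ⊢T v 0)))

data SeqAx : Formula SeqL 0 → Set where
  seq1 : SeqAx Seq1
  seq2 : SeqAx Seq2
  seq3 : SeqAx Seq3
  seq4 : SeqAx Seq4
  seq5 : SeqAx Seq5

data NoFun : Set where

data ASTRel : Set where
  mem : ASTRel

ASTL : Sig
ASTL = record { Fun = NoFun ; fArity = λ () ; Rel = ASTRel ; rArity = λ _ → 2 }

infix 6 _∈'_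
_∈'_ : ∀ {n} → Fin n → Fin n → Formula ASTL n
x ∈' y = rel mem (var x ∷ var y ∷ [])

ASTempty : Formula ASTL 0
ASTempty = ∃' (∀' (¬' (# 0 ∈' # 1)))

ASTadj : Formula ASTL 0
ASTadj = ∀' (∀' (∃' (∀' ((# 0 ∈' # 1) ⇔ ((# 0 ∈' # 3) ∨' (var (# 0) ≐ var (# 2)))))))

data ASTAx : Formula ASTL 0 → Set where
  ast-empty : ASTAx ASTempty
  ast-adj   : ASTAx ASTadj

-- Direct interpretations of AST in a theory in the language of Seq:
-- a formula δ(x,y) translating x ∈ y; the domain is not relativized and
-- equality is translated as equality.

trT : ∀ {n} → Term ASTL n → Term SeqL n
trT (var i)    = var i
trT (app () _)

pair2 : ∀ {n} → Term SeqL n → Term SeqL n → Fin 2 → Term SeqL n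
pair2 s t fz      = s
pair2 s t (fs fz) = t

translate : (δ : Formula SeqL 2) → ∀ {n} → Formula ASTL n → Formula SeqL n
translate δ ⊥'                      = ⊥'
translate δ (rel mem (s ∷ t ∷ []))  = subF (pair2 (trT s) (trT t)) δ
translate δ (s ≐ t)                 = trT s ≐ trT t
translate δ (φ ⇒ ψ)                 = translate δ φ ⇒ translate δ ψ
translate δ (∀' φ)                  = ∀' (translate δ φ)

DirectlyInterpretsAST : (Formula SeqL 0 → Set) → Set
DirectlyInterpretsAST T =
  Σ (Formula SeqL 2) λ δ → ∀ φ → ASTAx φ → T ⊢ translate δ φ

data μR : ℕ → Set where
  Z    : μR 0
  S    : μR 1
  P    : ∀ {n} → Fin n → μR n
  comp : ∀ {n m} → μR m → Vec (μR n) m → μR n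
  prec : ∀ {n} → μR n → μR (suc (suc n)) → μR (suc n)
  mini : ∀ {n} → μR (suc n) → μR n

data _[_]↓_ : ∀ {n} → μR n → Vec ℕ n → ℕ → Set
data _[_]↓*_ : ∀ {n m} → Vec (μR n) m → Vec ℕ n → Vec ℕ m → Set

data _[_]↓_ where
  evZ    : Z [ [] ]↓ 0
  evS    : ∀ {x} → S [ x ∷ [] ]↓ suc x
  evP    : ∀ {n} {i : Fin n} {xs} → P i [ xs ]↓ lookup xs i
  evComp : ∀ {n m} {f : μR m} {gs : Vec (μR n) m} {xs ys y} →
           gs [ xs ]↓* ys → f [ ys ]↓ y → comp f gs [ xs ]↓ y
  evPrec0 : ∀ {n} {f : μR n} {g} {xs y} →
            f [ xs ]↓ y → prec f g [ 0 ∷ xs ]↓ y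
  evPrecS : ∀ {n} {f : μR n} {g} {k xs r y} →
            prec f g [ k ∷ xs ]↓ r → g [ k ∷ r ∷ xs ]↓ y →
            prec f g [ suc k ∷ xs ]↓ y
  evMini : ∀ {n} {f : μR (suc n)} {xs k} →
           f [ k ∷ xs ]↓ 0 →
           (∀ j → j < k → Σ ℕ λ m → f [ j ∷ xs ]↓ suc m) →
           mini f [ xs ]↓ k

data _[_]↓*_ where
  ev[] : ∀ {n} {xs : Vec ℕ n} → [] [ xs ]↓* []
  ev∷  : ∀ {n m} {g : μR n} {gs : Vec (μR n) m} {xs y ys} →
         g [ xs ]↓ y → gs [ xs ]↓* ys → (g ∷ gs) [ xs ]↓* (y ∷ ys)

Recursive : (ℕ → Set) → Set
Recursive A = Σ (μR 1) λ f →
  ∀ k → (A k → f [ k ∷ [] ]↓ 1) × (¬ A k → f [ k ∷ [] ]↓ 0)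

pair : ℕ → ℕ → ℕ
pair a b = 2 ^ a * suc (2 * b)

codeFun : SeqFun → ℕ
codeFun e    = 0
codeFun tu   = 1
codeFun circ = 2

codeT  : ∀ {n} → Term SeqL n → ℕ
codeTs : ∀ {n k} → Vec (Term SeqL n) k → ℕ
codeT (var i)    = pair 0 (toℕ i)
codeT (app f ts) = pair 1 (pair (codeFun f) (codeTs ts))
codeTs []       = 0
codeTs (t ∷ ts) = suc (pair (codeT t) (codeTs ts))

code : ∀ {n} → Formula SeqL n → ℕ
code ⊥'        = pair 0 0
code (rel () _)
code (s ≐ t)   = pair 1 (pair (codeT s) (codeT t))
code (φ ⇒ ψ)   = pair 2 (pair (code φ) (code ψ))
code (∀' φ)    = pair 3 (code φ)

TheoremCodes : (Formula SeqL 0 → Set) → ℕ → Set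
TheoremCodes U k = Σ (Formula SeqL 0) λ φ → (code φ ≡ k) × (U ⊢ φ)

Decidable-Theory : (Formula SeqL 0 → Set) → Set
Decidable-Theory U = Recursive (TheoremCodes U)

EssentiallyUndecidable : (Formula SeqL 0 → Set) → Set₁
EssentiallyUndecidable T =
  (U : Formula SeqL 0 → Set) →
  (∀ φ → T ⊢ φ → U ⊢ φ) →
  ¬ (U ⊢ ⊥') →
  ¬ Decidable-Theory U

Sequential : (Formula SeqL 0 → Set) → Set
Sequential = DirectlyInterpretsAST

{-# OPTIONS --safe #-}
module Submission where

-- For (i), x is an element of s when s = (u ⊢ x) ∘ w for some u and w; then e is empty and s ⊢ y
-- adjoins y to s. For (ii), every μ-recursive function is representable in Seq, with numerals
-- e, e ⊢ e, (e ⊢ e) ⊢ e, … and pairs a ⊢ b. No order on numbers is needed: primitive recursion and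
-- minimisation are expressed by the existence of a set closed under suitable conditions, and a
-- metainduction on the standard numerals shows that any such set, standard or not, gives the right
-- value. A decision procedure for an extension of Seq is then refuted by a sentence stating its
-- own unprovability, namely ∀x (x = n → φ(x)) with n the code of φ, whose code needs no
-- substitution function.

open import Defs
open import Data.Nat using (ℕ; zero; suc; _+_; _*_; _^_; _≤_; _<_; z≤n; s≤s)
open import Data.Nat.Properties
  using (suc-injective; *-cancelˡ-≡; even≢odd; *-assoc; *-identityˡ; *-suc; ≤-pred; ≤-refl; ≤∧≢⇒<; _≟_; <⇒≤)
open import Data.Fin using (Fin; toℕ; _↑ˡ_; _↑ʳ_) renaming (zero to fz; suc to fs)
open import Data.Fin.Properties using (toℕ-injective)
open import Data.Vec using (Vec; []; _∷_; lookup; _++_)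
open import Data.Vec.Properties using (lookup-++ˡ; lookup-++ʳ)
open import Data.List using (List; map; upTo) renaming ([] to ε; _∷_ to _,,_)
open import Data.List.Membership.Propositional using (_∈_)
open import Data.List.Membership.Propositional.Properties using (∈-map⁺; ∈-map⁻; ∈-upTo⁺; ∈-upTo⁻)
open import Data.List.Relation.Unary.Any using (here; there)
open import Data.Product using (Σ; _×_; _,_; proj₁; proj₂)
open import Data.Empty using (⊥; ⊥-elim)
open import Function using (_∘_; id; case_of_)
open import Relation.Nullary using (¬_; yes; no)
open import Relation.Binary.PropositionalEquality
  using (_≡_; refl; sym; trans; cong; cong₂; subst)

-- Renaming and substitution

infixr 5 _◂_
_◂_ : ∀ {a} {A : Set a} {n} → A → (Fin n → A) → Fin (suc n) → A
(a ◂ σ) fz     = a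
(a ◂ σ) (fs i) = σ i

module _ {L : Sig} where

  subT-cong : ∀ {n m} {σ τ : Fin n → Term L m} → (∀ i → σ i ≡ τ i) → ∀ t → subT σ t ≡ subT τ t
  subTs-cong : ∀ {n m k} {σ τ : Fin n → Term L m} → (∀ i → σ i ≡ τ i) →
               (ts : Vec (Term L n) k) → subTs σ ts ≡ subTs τ ts
  subT-cong h (var i)    = h i
  subT-cong h (app f ts) = cong (app f) (subTs-cong h ts)
  subTs-cong h []       = refl
  subTs-cong h (t ∷ ts) = cong₂ _∷_ (subT-cong h t) (subTs-cong h ts)

  subF-cong : ∀ {n m} {σ τ : Fin n → Term L m} → (∀ i → σ i ≡ τ i) → ∀ φ → subF σ φ ≡ subF τ φ
  subF-cong h ⊥'         = refl
  subF-cong h (rel r ts) = cong (rel r) (subTs-cong h ts)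
  subF-cong h (s ≐ t)    = cong₂ _≐_ (subT-cong h s) (subT-cong h t)
  subF-cong h (φ ⇒ ψ)    = cong₂ _⇒_ (subF-cong h φ) (subF-cong h ψ)
  subF-cong h (∀' φ)     = cong ∀' (subF-cong (λ { fz → refl ; (fs i) → cong (renT fs) (h i) }) φ)

  renT≡subT : ∀ {n m} (ρ : Fin n → Fin m) (t : Term L n) → renT ρ t ≡ subT (var ∘ ρ) t
  renTs≡subTs : ∀ {n m k} (ρ : Fin n → Fin m) (ts : Vec (Term L n) k) → renTs ρ ts ≡ subTs (var ∘ ρ) ts
  renT≡subT ρ (var i)    = refl
  renT≡subT ρ (app f ts) = cong (app f) (renTs≡subTs ρ ts)
  renTs≡subTs ρ []       = refl
  renTs≡subTs ρ (t ∷ ts) = cong₂ _∷_ (renT≡subT ρ t) (renTs≡subTs ρ ts)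

  renF≡subF : ∀ {n m} (ρ : Fin n → Fin m) (φ : Formula L n) → renF ρ φ ≡ subF (var ∘ ρ) φ
  renF≡subF ρ ⊥'         = refl
  renF≡subF ρ (rel r ts) = cong (rel r) (renTs≡subTs ρ ts)
  renF≡subF ρ (s ≐ t)    = cong₂ _≐_ (renT≡subT ρ s) (renT≡subT ρ t)
  renF≡subF ρ (φ ⇒ ψ)    = cong₂ _⇒_ (renF≡subF ρ φ) (renF≡subF ρ ψ)
  renF≡subF ρ (∀' φ)     = cong ∀' (trans (renF≡subF (liftR {L} ρ) φ)
    (subF-cong (λ { fz → refl ; (fs i) → refl }) φ))

  subT-renT : ∀ {n m k} (σ : Fin m → Term L k) (ρ : Fin n → Fin m) (t : Term L n) →
              subT σ (renT ρ t) ≡ subT (σ ∘ ρ) t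
  subTs-renTs : ∀ {n m k l} (σ : Fin m → Term L k) (ρ : Fin n → Fin m) (ts : Vec (Term L n) l) →
                subTs σ (renTs ρ ts) ≡ subTs (σ ∘ ρ) ts
  subT-renT σ ρ (var i)    = refl
  subT-renT σ ρ (app f ts) = cong (app f) (subTs-renTs σ ρ ts)
  subTs-renTs σ ρ []       = refl
  subTs-renTs σ ρ (t ∷ ts) = cong₂ _∷_ (subT-renT σ ρ t) (subTs-renTs σ ρ ts)

  subT-subT : ∀ {n m k} (σ : Fin m → Term L k) (τ : Fin n → Term L m) (t : Term L n) →
              subT σ (subT τ t) ≡ subT (subT σ ∘ τ) t
  subTs-subTs : ∀ {n m k l} (σ : Fin m → Term L k) (τ : Fin n → Term L m) (ts : Vec (Term L n) l) →
                subTs σ (subTs τ ts) ≡ subTs (subT σ ∘ τ) ts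
  subT-subT σ τ (var i)    = refl
  subT-subT σ τ (app f ts) = cong (app f) (subTs-subTs σ τ ts)
  subTs-subTs σ τ []       = refl
  subTs-subTs σ τ (t ∷ ts) = cong₂ _∷_ (subT-subT σ τ t) (subTs-subTs σ τ ts)

  renT-subT : ∀ {n m k} (ρ : Fin m → Fin k) (σ : Fin n → Term L m) (t : Term L n) →
              renT ρ (subT σ t) ≡ subT (renT ρ ∘ σ) t
  renT-subT ρ σ t = trans (renT≡subT ρ (subT σ t)) (trans (subT-subT _ σ t)
    (subT-cong (λ i → sym (renT≡subT ρ (σ i))) t))

  liftS-∘ : ∀ {n m k} (σ : Fin m → Term L k) (τ : Fin n → Term L m) (i : Fin (suc n)) →
            subT (liftS σ) (liftS τ i) ≡ liftS (subT σ ∘ τ) i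
  liftS-∘ σ τ fz     = refl
  liftS-∘ σ τ (fs i) = trans (subT-renT (liftS σ) fs (τ i)) (sym (renT-subT fs σ (τ i)))

  subF-subF : ∀ {n m k} (σ : Fin m → Term L k) (τ : Fin n → Term L m) (φ : Formula L n) →
              subF σ (subF τ φ) ≡ subF (subT σ ∘ τ) φ
  subF-subF σ τ ⊥'         = refl
  subF-subF σ τ (rel r ts) = cong (rel r) (subTs-subTs σ τ ts)
  subF-subF σ τ (s ≐ t)    = cong₂ _≐_ (subT-subT σ τ s) (subT-subT σ τ t)
  subF-subF σ τ (φ ⇒ ψ)    = cong₂ _⇒_ (subF-subF σ τ φ) (subF-subF σ τ ψ)
  subF-subF σ τ (∀' φ)     = cong ∀' (trans (subF-subF (liftS σ) (liftS τ) φ) (subF-cong (liftS-∘ σ τ) φ))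

  renF-subF : ∀ {n m k} (ρ : Fin m → Fin k) (σ : Fin n → Term L m) (φ : Formula L n) →
              renF ρ (subF σ φ) ≡ subF (renT ρ ∘ σ) φ
  renF-subF ρ σ φ = trans (renF≡subF ρ (subF σ φ)) (trans (subF-subF _ σ φ)
    (subF-cong (λ i → sym (renT≡subT ρ (σ i))) φ))

  subF-renF : ∀ {n m k} (σ : Fin m → Term L k) (ρ : Fin n → Fin m) (φ : Formula L n) →
              subF σ (renF ρ φ) ≡ subF (σ ∘ ρ) φ
  subF-renF σ ρ φ = trans (cong (subF σ) (renF≡subF ρ φ)) (subF-subF σ (var ∘ ρ) φ)

  renF-renF : ∀ {n m k} (ρ : Fin m → Fin k) (ρ' : Fin n → Fin m) (φ : Formula L n) →
              renF ρ (renF ρ' φ) ≡ renF (ρ ∘ ρ') φ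
  renF-renF ρ ρ' φ = trans (renF≡subF ρ (renF ρ' φ)) (trans (subF-renF (var ∘ ρ) ρ' φ)
    (sym (renF≡subF (ρ ∘ ρ') φ)))

  subT-id : ∀ {n} {σ : Fin n → Term L n} → (∀ i → σ i ≡ var i) → ∀ t → subT σ t ≡ t
  subTs-id : ∀ {n k} {σ : Fin n → Term L n} → (∀ i → σ i ≡ var i) → (ts : Vec (Term L n) k) → subTs σ ts ≡ ts
  subT-id h (var i)    = h i
  subT-id h (app f ts) = cong (app f) (subTs-id h ts)
  subTs-id h []       = refl
  subTs-id h (t ∷ ts) = cong₂ _∷_ (subT-id h t) (subTs-id h ts)

  subF-id : ∀ {n} {σ : Fin n → Term L n} → (∀ i → σ i ≡ var i) → ∀ φ → subF σ φ ≡ φ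
  subF-id h ⊥'         = refl
  subF-id h (rel r ts) = cong (rel r) (subTs-id h ts)
  subF-id h (s ≐ t)    = cong₂ _≐_ (subT-id h s) (subT-id h t)
  subF-id h (φ ⇒ ψ)    = cong₂ _⇒_ (subF-id h φ) (subF-id h ψ)
  subF-id h (∀' φ)     = cong ∀' (subF-id (λ { fz → refl ; (fs i) → cong (renT fs) (h i) }) φ)

  renF-id : ∀ {n} (φ : Formula L n) → renF id φ ≡ φ
  renF-id φ = trans (renF≡subF id φ) (subF-id (λ _ → refl) φ)

  sub0-renT : ∀ {n} (t s : Term L n) → subT (sub0 t) (renT fs s) ≡ s
  sub0-renT t s = trans (subT-renT (sub0 t) fs s) (subT-id (λ _ → refl) s)

  -- Instantiating a quantifier under a substitution collapses to one substitution. Later formulas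
  -- can thus be kept as `subF σ φ` with `φ` fixed, the quantifier rules merely extending `σ` by
  -- `◂`.
  sub0-liftS : ∀ {n m} (t : Term L m) (σ : Fin n → Term L m) (φ : Formula L (suc n)) →
               subF (liftS σ) φ [ t ] ≡ subF (t ◂ σ) φ
  sub0-liftS t σ φ = trans (subF-subF (sub0 t) (liftS σ) φ)
    (subF-cong (λ { fz → refl ; (fs i) → sub0-renT t (σ i) }) φ)

  renF-[] : ∀ {n m} (ρ : Fin n → Fin m) (φ : Formula L (suc n)) (t : Term L n) →
            renF ρ (φ [ t ]) ≡ renF (liftR {L} ρ) φ [ renT ρ t ]
  renF-[] ρ φ t = trans (renF-subF ρ (sub0 t) φ) (trans
    (subF-cong (λ { fz → refl ; (fs i) → refl }) φ)
    (sym (subF-renF (sub0 (renT ρ t)) (liftR {L} ρ) φ)))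

  closed : ∀ {n} → Term L 0 → Term L n
  closed = renT (λ ())

  subT-closed : ∀ {n m} (σ : Fin n → Term L m) (t : Term L 0) → subT σ (closed t) ≡ closed t
  subT-closed σ t = trans (subT-renT σ (λ ()) t)
    (trans (subT-cong (λ ()) t) (sym (renT≡subT (λ ()) t)))

  renT-closed : ∀ {n m} (ρ : Fin n → Fin m) (t : Term L 0) → renT ρ (closed t) ≡ closed t
  renT-closed ρ t = trans (renT≡subT ρ (closed t)) (subT-closed (var ∘ ρ) t)

-- Derived rules of the calculus

module _ {L : Sig} {T : Formula L 0 → Set} where

  -- Induction on derivations. Renaming and inclusion of hypotheses are treated together, so that
  -- weakening (`ρ = id`) and passing under a quantifier (`ρ = fs`) are both instances.
  rename : ∀ {n m} {Γ : List (Formula L n)} {Δ : List (Formula L m)} {φ} (ρ : Fin n → Fin m) →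
           (∀ {ψ} → ψ ∈ Γ → renF ρ ψ ∈ Δ) → T ⨾ Γ ⊢ φ → T ⨾ Δ ⊢ renF ρ φ
  rename {Δ = Δ} ρ h (axiom {ψ = ψ} a) = subst (T ⨾ Δ ⊢_) (sym eq) (axiom a)
    where
    eq : renF ρ (wkSentence ψ) ≡ wkSentence ψ
    eq = trans (renF-renF ρ (λ ()) ψ) (trans (renF≡subF _ ψ)
           (trans (subF-cong (λ ()) ψ) (sym (renF≡subF (λ ()) ψ))))
  rename ρ h (hyp i)   = hyp (h i)
  rename ρ h (⇒I d)    = ⇒I (rename ρ (λ { (here refl) → here refl ; (there i) → there (h i) }) d)
  rename ρ h (⇒E d d') = ⇒E (rename ρ h d) (rename ρ h d')
  rename ρ h (raa d)   = raa (rename ρ (λ { (here refl) → here refl ; (there i) → there (h i) }) d)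
  rename {Γ = Γ} {Δ} ρ h (∀I d) = ∀I (rename (liftR {L} ρ) lifted d)
    where
    lifted : ∀ {ψ} → ψ ∈ map (renF fs) Γ → renF (liftR {L} ρ) ψ ∈ map (renF fs) Δ
    lifted i with ∈-map⁻ (renF fs) i
    ... | ψ , j , refl = subst (_∈ map (renF fs) Δ)
          (trans (renF-renF fs ρ ψ) (sym (renF-renF (liftR {L} ρ) fs ψ))) (∈-map⁺ (renF fs) (h j))
  rename {Δ = Δ} ρ h (∀E {φ = φ} d t) = subst (T ⨾ Δ ⊢_) (sym (renF-[] ρ φ t)) (∀E (rename ρ h d) (renT ρ t))
  rename ρ h (≐refl t) = ≐refl (renT ρ t)
  rename {Δ = Δ} ρ h (≐subst {s = s} {t} φ d d') = subst (T ⨾ Δ ⊢_) (sym (renF-[] ρ φ t))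
    (≐subst (renF (liftR {L} ρ) φ) (rename ρ h d) (subst (T ⨾ Δ ⊢_) (renF-[] ρ φ s) (rename ρ h d')))

  weaken : ∀ {n} {Γ : List (Formula L n)} {φ ψ} → T ⨾ Γ ⊢ φ → T ⨾ (ψ ,, Γ) ⊢ φ
  weaken {Γ = Γ} {φ} {ψ} d = subst (T ⨾ (ψ ,, Γ) ⊢_) (renF-id φ)
    (rename id (λ {χ} i → there (subst (_∈ Γ) (sym (renF-id χ)) i)) d)

  shift : ∀ {n} {Γ : List (Formula L n)} {φ} → T ⨾ Γ ⊢ φ → T ⨾ map (renF fs) Γ ⊢ renF fs φ
  shift = rename fs (∈-map⁺ (renF fs))

  hyp₀ : ∀ {n} {Γ : List (Formula L n)} {φ} → T ⨾ (φ ,, Γ) ⊢ φ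
  hyp₀ = hyp (here refl)

  hyp₁ : ∀ {n} {Γ : List (Formula L n)} {φ ψ} → T ⨾ (ψ ,, φ ,, Γ) ⊢ φ
  hyp₁ = hyp (there (here refl))

  ⊥E : ∀ {n} {Γ : List (Formula L n)} {φ} → T ⨾ Γ ⊢ ⊥' → T ⨾ Γ ⊢ φ
  ⊥E d = raa (weaken d)

  ∧I : ∀ {n} {Γ : List (Formula L n)} {φ ψ} → T ⨾ Γ ⊢ φ → T ⨾ Γ ⊢ ψ → T ⨾ Γ ⊢ (φ ∧' ψ)
  ∧I d d' = ⇒I (⇒E (⇒E hyp₀ (weaken d)) (weaken d'))

  ∧E₁ : ∀ {n} {Γ : List (Formula L n)} {φ ψ} → T ⨾ Γ ⊢ (φ ∧' ψ) → T ⨾ Γ ⊢ φ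
  ∧E₁ d = raa (⇒E (weaken d) (⇒I (⊥E (⇒E hyp₁ hyp₀))))

  ∧E₂ : ∀ {n} {Γ : List (Formula L n)} {φ ψ} → T ⨾ Γ ⊢ (φ ∧' ψ) → T ⨾ Γ ⊢ ψ
  ∧E₂ d = raa (⇒E (weaken d) (⇒I (weaken hyp₀)))

  ∨I₁ : ∀ {n} {Γ : List (Formula L n)} {φ ψ} → T ⨾ Γ ⊢ φ → T ⨾ Γ ⊢ (φ ∨' ψ)
  ∨I₁ d = ⇒I (⊥E (⇒E hyp₀ (weaken d)))

  ∨I₂ : ∀ {n} {Γ : List (Formula L n)} {φ ψ} → T ⨾ Γ ⊢ ψ → T ⨾ Γ ⊢ (φ ∨' ψ)
  ∨I₂ d = ⇒I (weaken d)

  ∨E : ∀ {n} {Γ : List (Formula L n)} {φ ψ χ} →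
       T ⨾ Γ ⊢ (φ ∨' ψ) → T ⨾ Γ ⊢ (φ ⇒ χ) → T ⨾ Γ ⊢ (ψ ⇒ χ) → T ⨾ Γ ⊢ χ
  ∨E d f g = raa (⇒E hyp₀ (⇒E (weaken g)
    (⇒E (weaken d) (⇒I (⇒E hyp₁ (⇒E (weaken (weaken f)) hyp₀))))))

  inst : ∀ {n} {Γ : List (Formula L n)} {m} (σ : Fin m → Term L n) (φ : Formula L (suc m)) →
         T ⨾ Γ ⊢ subF σ (∀' φ) → ∀ t → T ⨾ Γ ⊢ subF (t ◂ σ) φ
  inst {Γ = Γ} σ φ d t = subst (T ⨾ Γ ⊢_) (sub0-liftS t σ φ) (∀E d t)

  ∃I : ∀ {n} {Γ : List (Formula L n)} {m} (σ : Fin m → Term L n) (φ : Formula L (suc m)) t →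
       T ⨾ Γ ⊢ subF (t ◂ σ) φ → T ⨾ Γ ⊢ subF σ (∃' φ)
  ∃I σ φ t d = ⇒I (⇒E (inst σ (¬' φ) hyp₀ t) (weaken d))

  ∃E : ∀ {n} {Γ : List (Formula L n)} {φ χ} →
       T ⨾ Γ ⊢ ∃' φ → T ⨾ (φ ,, map (renF fs) Γ) ⊢ renF fs χ → T ⨾ Γ ⊢ χ
  ∃E {Γ = Γ} d d' = raa (⇒E (weaken d) (∀I (⇒I (⇒E (weaken hyp₀)
    (⇒E (weaken (weaken (⇒I d'))) hyp₀)))))

  -- Replacement happens at variable 0 of `φ`, while `σ` carries the parameters that stay fixed.
  ≐leib : ∀ {n} {Γ : List (Formula L n)} {m} (σ : Fin m → Term L n) (φ : Formula L (suc m)) {s t} →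
          T ⨾ Γ ⊢ (s ≐ t) → T ⨾ Γ ⊢ subF (s ◂ σ) φ → T ⨾ Γ ⊢ subF (t ◂ σ) φ
  ≐leib {Γ = Γ} σ φ {s} {t} q d = subst (T ⨾ Γ ⊢_) (sub0-liftS t σ φ)
    (≐subst (subF (liftS σ) φ) q (subst (T ⨾ Γ ⊢_) (sym (sub0-liftS s σ φ)) d))

  ≐sym : ∀ {n} {Γ : List (Formula L n)} {s t} → T ⨾ Γ ⊢ (s ≐ t) → T ⨾ Γ ⊢ (t ≐ s)
  ≐sym {s = s} q = ≐leib {m = 1} (s ◂ λ ()) (var fz ≐ var (fs fz)) q (≐refl s)

  ≐trans : ∀ {n} {Γ : List (Formula L n)} {s t u} → T ⨾ Γ ⊢ (s ≐ t) → T ⨾ Γ ⊢ (t ≐ u) → T ⨾ Γ ⊢ (s ≐ u)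
  ≐trans {s = s} p q = ≐leib {m = 1} (s ◂ λ ()) (var (fs fz) ≐ var fz) q p

  axiom' : ∀ {n} {Γ : List (Formula L n)} {ψ} → T ψ → T ⨾ Γ ⊢ subF (λ ()) ψ
  axiom' {Γ = Γ} {ψ} a = subst (T ⨾ Γ ⊢_) (trans (renF≡subF (λ ()) ψ) (subF-cong (λ ()) ψ)) (axiom a)

-- Membership in Seq

infix 3 _⊩_
_⊩_ : ∀ {n} → List (Formula SeqL n) → Formula SeqL n → Set
Γ ⊩ φ = SeqAx ⨾ Γ ⊢ φ

Ctx : ℕ → Set
Ctx n = List (Formula SeqL n)

-- Under the quantifiers, variables 3 and 2 are the set and the element, 1 and 0 the part `u` below
-- the element and the part `w` above it. Proofs about membership split `w` by `Seq5`, after which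
-- `Seq3` or `Seq4` computes the product.
memF : Formula SeqL 2
memF = ∃' (∃' (v 3 ≐ (v 1 ⊢T v 2) ∘T v 0))

infix 6 _∈ˢ_
_∈ˢ_ : ∀ {n} → Term SeqL n → Term SeqL n → Formula SeqL n
x ∈ˢ s = subF (pair2 x s) memF

subF-pair2 : ∀ {n} (σ : Fin 2 → Term SeqL n) {x s} (φ : Formula SeqL 2) → σ fz ≡ x → σ (fs fz) ≡ s →
             subF σ φ ≡ subF (pair2 x s) φ
subF-pair2 σ φ p q = subF-cong (λ { fz → p ; (fs fz) → q }) φ

subF-∈ˢ : ∀ {n m} (σ : Fin n → Term SeqL m) x s → subF σ (x ∈ˢ s) ≡ subT σ x ∈ˢ subT σ s
subF-∈ˢ σ x s = trans (subF-subF σ (pair2 x s) memF) (subF-pair2 (subT σ ∘ pair2 x s) memF refl refl)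

renF-∈ˢ : ∀ {n m} (ρ : Fin n → Fin m) x s → renF ρ (x ∈ˢ s) ≡ renT ρ x ∈ˢ renT ρ s
renF-∈ˢ ρ x s = trans (renF-subF ρ (pair2 x s) memF) (subF-pair2 (renT ρ ∘ pair2 x s) memF refl refl)

conv : ∀ {n} {Γ : Ctx n} {φ ψ} → φ ≡ ψ → Γ ⊩ φ → Γ ⊩ ψ
conv refl d = d

module _ {n} {Γ : Ctx n} where

  inst₁ : ∀ {φ} → SeqAx (∀' φ) → ∀ t → Γ ⊩ subF (t ◂ λ ()) φ
  inst₁ {φ} a = inst (λ ()) φ (axiom' a)

  inst₂ : ∀ {φ} → SeqAx (∀' (∀' φ)) → ∀ t u → Γ ⊩ subF (u ◂ t ◂ λ ()) φ
  inst₂ {φ} a t = inst (t ◂ λ ()) φ (inst₁ a t)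

  inst₃ : ∀ {φ} → SeqAx (∀' (∀' (∀' φ))) → ∀ t u w → Γ ⊩ subF (w ◂ u ◂ t ◂ λ ()) φ
  inst₃ {φ} a t u = inst (u ◂ t ◂ λ ()) φ (inst₂ a t u)

  inst₄ : ∀ {φ} → SeqAx (∀' (∀' (∀' (∀' φ)))) → ∀ t u w x → Γ ⊩ subF (x ◂ w ◂ u ◂ t ◂ λ ()) φ
  inst₄ {φ} a t u w = inst (w ◂ u ◂ t ◂ λ ()) φ (inst₃ a t u w)

  ⊢T-≢e : ∀ {a b} → Γ ⊩ a ⊢T b ≐ eT → Γ ⊩ ⊥'
  ⊢T-≢e {a} {b} = ⇒E (inst₂ seq1 a b)

  ⊢T-injˡ : ∀ {a b c d} → Γ ⊩ a ⊢T b ≐ c ⊢T d → Γ ⊩ a ≐ c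
  ⊢T-injˡ q = ∧E₁ (⇒E (inst₄ seq2 _ _ _ _) q)

  ⊢T-injʳ : ∀ {a b c d} → Γ ⊩ a ⊢T b ≐ c ⊢T d → Γ ⊩ b ≐ d
  ⊢T-injʳ q = ∧E₂ (⇒E (inst₄ seq2 _ _ _ _) q)

  ⊢T-cong : ∀ {a b c d} → Γ ⊩ a ≐ c → Γ ⊩ b ≐ d → Γ ⊩ a ⊢T b ≐ c ⊢T d
  ⊢T-cong {a} {b} {c} p q = ≐trans
    (≐leib {m = 2} (a ◂ b ◂ λ ()) (v 1 ⊢T v 2 ≐ v 0 ⊢T v 2) p (≐refl _))
    (≐leib {m = 2} (c ◂ b ◂ λ ()) (v 1 ⊢T v 2 ≐ v 1 ⊢T v 0) q (≐refl _))

  ∘T-congʳ : ∀ {a b c} → Γ ⊩ b ≐ c → Γ ⊩ a ∘T b ≐ a ∘T c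
  ∘T-congʳ {a} {b} q = ≐leib {m = 2} (a ◂ b ◂ λ ()) (v 1 ∘T v 2 ≐ v 1 ∘T v 0) q (≐refl _)

  ∘T-e : ∀ {a b} → Γ ⊩ b ≐ eT → Γ ⊩ a ∘T b ≐ a
  ∘T-e q = ≐trans (∘T-congʳ q) (inst₁ seq3 _)

  ∘T-⊢T : ∀ {a b c d} → Γ ⊩ b ≐ c ⊢T d → Γ ⊩ a ∘T b ≐ (a ∘T c) ⊢T d
  ∘T-⊢T q = ≐trans (∘T-congʳ q) (inst₃ seq4 _ _ _)

module _ {n} {Γ : Ctx n} where

  ∃∃E : ∀ {φ χ} → Γ ⊩ ∃' (∃' φ) → φ ,, map (renF fs) (map (renF fs) Γ) ⊩ renF fs (renF fs χ) → Γ ⊩ χ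
  -- The outer elimination leaves the hypothesis `∃' φ` in between, which `d'` lacks; turned into an
  -- implication, `d'` can be weakened past it.
  ∃∃E d d' = ∃E d (∃E hyp₀ (⇒E (weaken (weaken (⇒I d'))) hyp₀))

module _ {n} {Γ : Ctx n} where

  caseE : ∀ {χ} t → t ≐ eT ,, Γ ⊩ χ →
          renT fs (renT fs t) ≐ v 1 ⊢T v 0 ,, map (renF fs) (map (renF fs) Γ) ⊩ renF fs (renF fs χ) →
          Γ ⊩ χ
  caseE t d d' = ∨E (inst₁ seq5 t) (⇒I d) (⇒I (∃∃E hyp₀ (⇒E (weaken (weaken (⇒I d'))) hyp₀)))

  to∈ : ∀ {m} (σ : Fin m → Term SeqL n) x s → Γ ⊩ subF σ (x ∈ˢ s) → Γ ⊩ subT σ x ∈ˢ subT σ s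
  to∈ σ x s = conv (subF-∈ˢ σ x s)

  from∈ : ∀ {m} (σ : Fin m → Term SeqL n) x s → Γ ⊩ subT σ x ∈ˢ subT σ s → Γ ⊩ subF σ (x ∈ˢ s)
  from∈ σ x s = conv (sym (subF-∈ˢ σ x s))

  ∈I : ∀ {x s} u w → Γ ⊩ s ≐ (u ⊢T x) ∘T w → Γ ⊩ x ∈ˢ s
  ∈I {x} {s} u w d = ∃I (pair2 x s) (∃' body) u (∃I (u ◂ pair2 x s) body w d)
    where
    body = v 3 ≐ (v 1 ⊢T v 2) ∘T v 0

  ∈-congʳ : ∀ {x s t} → Γ ⊩ s ≐ t → Γ ⊩ x ∈ˢ s → Γ ⊩ x ∈ˢ t
  ∈-congʳ {x} {s} {t} q d = to∈ {m = 2} (t ◂ x ◂ λ ()) (v 1) (v 0)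
    (≐leib {m = 1} (x ◂ λ ()) (v 1 ∈ˢ v 0) q (from∈ {m = 2} (s ◂ x ◂ λ ()) (v 1) (v 0) d))

  ∈-congˡ : ∀ {x y s} → Γ ⊩ x ≐ y → Γ ⊩ x ∈ˢ s → Γ ⊩ y ∈ˢ s
  ∈-congˡ {x} {y} {s} q d = to∈ {m = 2} (y ◂ s ◂ λ ()) (v 0) (v 1)
    (≐leib {m = 1} (s ◂ λ ()) (v 0 ∈ˢ v 1) q (from∈ {m = 2} (x ◂ s ◂ λ ()) (v 0) (v 1) d))

  ∈-top : ∀ {x s} → Γ ⊩ x ∈ˢ (s ⊢T x)
  ∈-top {x} {s} = ∈I s eT (≐sym (∘T-e (≐refl _)))

module _ {n} {Γ : Ctx n} where

  -- Splitting `c` shows the product to be of the form `_ ⊢ _` in any case: by `Seq3` if `c` is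
  -- empty, by `Seq4` otherwise. `Seq1` then applies.
  ∘T-≢e : ∀ {a b c} → Γ ⊩ eT ≐ (a ⊢T b) ∘T c → Γ ⊩ ⊥'
  ∘T-≢e {c = c} d = caseE c
    (⊢T-≢e (≐sym (≐trans (weaken d) (∘T-e hyp₀))))
    (⊢T-≢e (≐sym (≐trans (weaken (shift (shift d))) (∘T-⊢T hyp₀))))

module _ {n} {Γ : Ctx n} where

  ∈-e : ∀ {x} → Γ ⊩ x ∈ˢ eT → Γ ⊩ ⊥'
  ∈-e d = ∃∃E d (∘T-≢e hyp₀)

  -- `Seq4` brings the top of `w` outside the product, and `Seq2` then cancels the tops of both
  -- sides.
  ∈-pop : ∀ {x y s u w a b} → Γ ⊩ s ⊢T y ≐ (u ⊢T x) ∘T w → Γ ⊩ w ≐ a ⊢T b → Γ ⊩ x ∈ˢ s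
  ∈-pop {u = u} {a = a} p q = ∈I u a (⊢T-injˡ (≐trans p (∘T-⊢T q)))

  ∈-push : ∀ {x y s u w} → Γ ⊩ s ≐ (u ⊢T x) ∘T w → Γ ⊩ x ∈ˢ (s ⊢T y)
  ∈-push {y = y} {u = u} {w} p = ∈I u (w ⊢T y)
    (≐trans (⊢T-cong p (≐refl y)) (≐sym (∘T-⊢T (≐refl _))))

renF²-∈ˢ : ∀ {n} (x s : Term SeqL n) →
           renF fs (renF fs (x ∈ˢ s)) ≡ renT fs (renT fs x) ∈ˢ renT fs (renT fs s)
renF²-∈ˢ x s = trans (cong (renF fs) (renF-∈ˢ fs x s)) (renF-∈ˢ fs _ _)

module _ {n} {Γ : Ctx n} where

  -- If `w` is empty, `x` is itself the top and equals `y` by `Seq2`; otherwise the top of `w` is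
  -- `y` and can be popped.
  ∈-last : ∀ {x y s u w} → Γ ⊩ s ⊢T y ≐ (u ⊢T x) ∘T w → Γ ⊩ (x ∈ˢ s) ∨' (x ≐ y)
  ∈-last {x} {y} {s} {u} {w} d = caseE w
    (∨I₂ (≐sym (⊢T-injʳ (≐trans (weaken d) (∘T-e hyp₀)))))
    (∨I₁ (conv (sym (renF²-∈ˢ x s)) (∈-pop (weaken (shift (shift d))) hyp₀)))

module _ {n} {Γ : Ctx n} where

  ∈-⊢T⁻ : ∀ {x y s} → Γ ⊩ x ∈ˢ (s ⊢T y) → Γ ⊩ (x ∈ˢ s) ∨' (x ≐ y)
  ∈-⊢T⁻ {x} {y} {s} d = ∃∃E d (conv (cong (_∨' (renT fs (renT fs x) ≐ renT fs (renT fs y)))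
    (sym (renF²-∈ˢ x s))) (∈-last hyp₀))

  ∈-weaken : ∀ {x y s} → Γ ⊩ x ∈ˢ s → Γ ⊩ x ∈ˢ (s ⊢T y)
  ∈-weaken {x} {y} {s} d = ∃∃E d (conv (sym (renF²-∈ˢ x (s ⊢T y))) (∈-push hyp₀))

-- Direct interpretation of adjunctive set theory

sequential : Sequential SeqAx
sequential = memF , λ where
  -- `∃I` concludes a substitution instance, so the sentence is presented as its own instance under
  -- the empty substitution.
  _ ast-empty → conv (subF-id {σ = λ ()} (λ ()) (translate memF ASTempty))
    (∃I {m = 0} (λ ()) (∀' (¬' (v 0 ∈ˢ v 1))) eT
      (∀I (⇒I (∈-e (to∈ (liftS {n = 1} (eT ◂ λ ())) (v 0) (v 1) hyp₀)))))
  _ ast-adj → let σ = liftS ((v 1 ⊢T v 0) ◂ var) in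
    ∀I (∀I (conv (subF-id (λ _ → refl) _)
      (∃I var (∀' ((v 0 ∈ˢ v 1) ⇔ ((v 0 ∈ˢ v 3) ∨' (v 0 ≐ v 2)))) (v 1 ⊢T v 0)
        (∀I (∧I
          (⇒I (∨E (∈-⊢T⁻ (to∈ σ (v 0) (v 1) hyp₀)) (⇒I (∨I₁ (from∈ σ (v 0) (v 3) hyp₀))) (⇒I (∨I₂ hyp₀))))
          (⇒I (∨E hyp₀
            (⇒I (from∈ σ (v 0) (v 1) (∈-weaken (to∈ σ (v 0) (v 3) hyp₀))))
            (⇒I (from∈ σ (v 0) (v 1) (∈-congˡ (≐sym hyp₀) ∈-top))))))))))

-- Representability of recursive functions

num : ℕ → Term SeqL 0
num zero    = eT
num (suc k) = num k ⊢T eT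

Num : ∀ {n} → Ctx n → Term SeqL n → ℕ → Set
Num Γ t k = Γ ⊩ t ≐ closed (num k)

module _ {n} {Γ : Ctx n} where

  Num-closed : ∀ {m} (ρ : Fin m → Fin n) k → Num Γ (renT ρ (closed (num k))) k
  Num-closed ρ k = conv (cong (_≐ closed (num k)) (sym (renT-closed ρ (num k)))) (≐refl _)

  Num-shift : ∀ {t k} → Num Γ t k → Num (map (renF fs) Γ) (renT fs t) k
  Num-shift {t} {k} d = conv (cong (renT fs t ≐_) (renT-closed fs (num k))) (shift d)

  Num-unshift : ∀ {m} (ρ : Fin m → Fin n) {t k} → Num Γ (renT ρ t) k → Γ ⊩ renF ρ (t ≐ closed (num k))
  Num-unshift ρ {t} {k} d = conv (cong (renT ρ t ≐_) (sym (renT-closed ρ (num k)))) d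

  Num-0≢suc : ∀ {t k} → Num Γ t 0 → Num Γ t (suc k) → Γ ⊩ ⊥'
  Num-0≢suc p q = ⊢T-≢e (≐trans (≐sym q) p)

module _ {A : Set} (enc : A → Term SeqL 0) where

  setT : List A → Term SeqL 0
  setT ε        = eT
  setT (a ,, L) = setT L ⊢T enc a

  ∈-setT⁺ : ∀ {n} {Γ : Ctx n} {a L} → a ∈ L → Γ ⊩ closed (enc a) ∈ˢ closed (setT L)
  ∈-setT⁺ (here refl) = ∈-top
  ∈-setT⁺ (there i)   = ∈-weaken (∈-setT⁺ i)

  -- Iterating `∈-⊢T⁻` along the list turns membership in a standard finite set into a case
  -- distinction made outside the theory.
  ∈-setT⁻ : ∀ {n} {Γ : Ctx n} {x χ} L → Γ ⊩ x ∈ˢ closed (setT L) →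
            (∀ a → a ∈ L → x ≐ closed (enc a) ,, Γ ⊩ χ) → Γ ⊩ χ
  ∈-setT⁻ ε        d f = ⊥E (∈-e d)
  ∈-setT⁻ (a ,, L) d f = ∨E (∈-⊢T⁻ d)
    (⇒I (∈-setT⁻ L hyp₀ (λ b i → ⇒E (weaken (weaken (⇒I (f b (there i))))) hyp₀)))
    (⇒I (f a (here refl)))

Env : ∀ {n m} → Ctx m → (Fin n → Term SeqL m) → Vec ℕ n → Set
Env Γ σ xs = ∀ i → Num Γ (σ i) (lookup xs i)

-- Variable 0 of F is the value, the others are the arguments. Arguments need only be provably equal
-- to numerals, so that both rules apply under arbitrary hypotheses without rewriting.
record Rep {n} (F : Formula SeqL (suc n)) (xs : Vec ℕ n) (y : ℕ) : Set where
  field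
    elim  : ∀ {m} {Γ : Ctx m} (σ : Fin (suc n) → Term SeqL m) → Env Γ (σ ∘ fs) xs →
            Γ ⊩ subF σ F → Num Γ (σ fz) y
    intro : ∀ {m} {Γ : Ctx m} (σ : Fin (suc n) → Term SeqL m) → Env Γ (σ ∘ fs) xs →
            Num Γ (σ fz) y → Γ ⊩ subF σ F
open Rep

module _ {n} {F : Formula SeqL (suc n)} {xs y} (R : Rep F xs y)
         {m k} {Γ : Ctx m} (σ : Fin k → Term SeqL m) (τ : Fin (suc n) → Term SeqL k)
         (h : Env Γ (subT σ ∘ τ ∘ fs) xs) where

  elim∘ : Γ ⊩ subF σ (subF τ F) → Num Γ (subT σ (τ fz)) y
  elim∘ d = elim R (subT σ ∘ τ) h (conv (subF-subF σ τ F) d)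

  intro∘ : Num Γ (subT σ (τ fz)) y → Γ ⊩ subF σ (subF τ F)
  intro∘ d = conv (sym (subF-subF σ τ F)) (intro R (subT σ ∘ τ) h d)

-- One existential quantifier of a composition. The bound variable holds the value of `G`, whose
-- arguments `ξ` selects among the outer ones; `swap` is there because in `F` the result `y`
-- precedes that value.
module Bind {n N} (ξ : Fin n → Fin N) (G : Formula SeqL (suc n)) (F : Formula SeqL (suc (suc N))) where

  args : Fin (suc n) → Term SeqL (suc (suc N))
  args = var fz ◂ λ i → var (fs (fs (ξ i)))

  swap : Fin (suc (suc N)) → Term SeqL (suc (suc N))
  swap = v 1 ◂ v 0 ◂ λ i → var (fs (fs i))

  bind : Formula SeqL (suc N)
  bind = ∃' (subF args G ∧' subF swap F)

  bind-rep : ∀ {xs as y z} → Rep G xs z → Rep F (z ∷ as) y →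
             (∀ i → lookup as (ξ i) ≡ lookup xs i) → Rep bind as y
  bind-rep {z = z} RG RF eq .elim σ h d = ∃E d (Num-unshift fs (elim∘ RF (liftS σ) swap
    -- `G` first pins the bound variable to the numeral of `z`; only with this do the arguments of
    -- `F` form an `Env`.
    (λ { fz → elim∘ RG (liftS σ) args
                (λ i → subst (Num _ _) (eq i) (weaken (Num-shift (h (ξ i))))) (∧E₁ hyp₀)
       ; (fs i) → weaken (Num-shift (h i)) }) (∧E₂ hyp₀)))
  bind-rep {z = z} RG RF eq .intro σ h d = ∃I σ _ (closed (num z)) (∧I
    (intro∘ RG (closed (num z) ◂ σ) args (λ i → subst (Num _ _) (eq i) (h (ξ i))) (≐refl _))
    (intro∘ RF (closed (num z) ◂ σ) swap (λ { fz → ≐refl _ ; (fs i) → h i }) d))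

open Bind using (bind; bind-rep)

-- F has its variables in the order y, z₁, …, zₖ, x₁, …, xₙ, and zᵢ is to be the value of the i-th formula.
exComp : ∀ {n k} → Vec (Formula SeqL (suc n)) k → Formula SeqL (suc (k + n)) → Formula SeqL (suc n)
exComp [] F = F
exComp {k = suc k} (G ∷ Gs) F = exComp Gs (bind (k ↑ʳ_) G F)

-- precF has variables y, k, xs. It asserts a set s with k ⊢ y ∈ s such that 0 ⊢ r ∈ s implies F(r, xs),
-- and (i + 1) ⊢ r' ∈ s implies G(r', i, r, xs) for some r with i ⊢ r ∈ s.
module Prec {n} (F : Formula SeqL (suc n)) (G : Formula SeqL (suc (suc (suc n)))) where

  -- Bound variables pile up in front of `xs`: `trace` reads `s, y, k`; `base'` reads `r, s, y, k`;
  -- `step'` reads `r', i, s, y, k`; and `back` puts `r` in front of the latter.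
  baseArgs : Fin (suc n) → Term SeqL (suc (suc (suc (suc n))))
  baseArgs = v 0 ◂ λ i → var (fs (fs (fs (fs i))))

  base' : Formula SeqL (suc (suc (suc (suc n))))
  base' = (eT ⊢T v 0) ∈ˢ v 1 ⇒ subF baseArgs F

  base : Formula SeqL (suc (suc (suc n)))
  base = ∀' base'

  stepArgs : Fin (suc (suc (suc n))) → Term SeqL (suc (suc (suc (suc (suc (suc n))))))
  stepArgs = v 1 ◂ v 2 ◂ v 0 ◂ λ i → var (fs (fs (fs (fs (fs (fs i))))))

  back : Formula SeqL (suc (suc (suc (suc (suc (suc n))))))
  back = ((v 2 ⊢T v 0) ∈ˢ v 3) ∧' subF stepArgs G

  step' : Formula SeqL (suc (suc (suc (suc (suc n)))))
  step' = ((v 1 ⊢T eT) ⊢T v 0) ∈ˢ v 2 ⇒ ∃' back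

  step : Formula SeqL (suc (suc (suc n)))
  step = ∀' (∀' step')

  trace : Formula SeqL (suc (suc (suc n)))
  trace = ((v 2 ⊢T v 1) ∈ˢ v 0) ∧' (base ∧' step)

  precF : Formula SeqL (suc (suc n))
  precF = ∃' trace

  pairT : ℕ × ℕ → Term SeqL 0
  pairT (j , u) = num j ⊢T num u

  module _ (xs : Vec ℕ n) where

    -- The conditions `base` and `step` read outside the theory, for a list of pairs of standard
    -- numbers.
    Justified : List (ℕ × ℕ) → ℕ → ℕ → Set
    Justified L zero    u = Rep F xs u
    Justified L (suc j) u = Σ ℕ λ w → (j , w) ∈ L × Rep G (j ∷ w ∷ xs) u

    Trace : List (ℕ × ℕ) → Set
    Trace L = ∀ {j u} → (j , u) ∈ L → Justified L j u

    module _ {L} (J : Trace L) where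

      -- Metainduction on `j`, for any term `σ fz` that satisfies the closure conditions. At 0,
      -- `base` yields `F` of `r`. At a successor, `step` supplies a predecessor, the induction
      -- hypothesis equates it with the value listed in `L`, and representability of `G` determines
      -- `r`.
      unique : ∀ j {u} → (j , u) ∈ L → ∀ {m} {Γ : Ctx m} (σ : Fin (suc (suc (suc n))) → Term SeqL m) →
               Env Γ (λ i → σ (fs (fs (fs i)))) xs → Γ ⊩ subF σ base → Γ ⊩ subF σ step →
               ∀ r → Γ ⊩ (closed (num j) ⊢T r) ∈ˢ σ fz → Num Γ r u
      unique zero i σ h b s r d = elim∘ (J i) (r ◂ σ) baseArgs h
        (⇒E (inst σ base' b r) (from∈ (r ◂ σ) (eT ⊢T v 0) (v 1) d))
      unique (suc j) {u} i {m} {Γ} σ h b s r d with J i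
      ... | w , i' , R = ∃E (⇒E (inst (closed (num j) ◂ σ) step' (inst σ (∀' step') s (closed (num j))) r)
                               (from∈ σ₂ ((v 1 ⊢T eT) ⊢T v 0) (v 2) d))
          (Num-unshift fs (elim∘ R (liftS σ₂) stepArgs
            (λ { fz → Num-closed fs j
               -- The induction hypothesis concerns the predecessor just introduced by `∃E`, in a
               -- larger context; hence the quantification over `Γ` and `σ`.
               ; (fs fz) → unique j i' (renT fs ∘ σ) (λ i → weaken (Num-shift (h i)))
                   (weaken (conv (renF-subF fs σ base) (shift b)))
                   (weaken (conv (renF-subF fs σ step) (shift s)))
                   (var fz)
                   (∈-congˡ (⊢T-cong (Num-closed fs j) (≐refl _))
                     (to∈ (liftS σ₂) (v 2 ⊢T v 0) (v 3) (∧E₁ hyp₀)))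
               ; (fs (fs i)) → weaken (Num-shift (h i)) })
            (∧E₂ hyp₀)))
        where
        σ₂ : Fin (suc (suc (suc (suc (suc n))))) → Term SeqL m
        σ₂ = r ◂ closed (num j) ◂ σ

      traceT : ∀ {m} → Term SeqL m
      traceT = closed (setT pairT L)

      -- Entries at a successor cannot match, by `Seq1`; for an entry at 0, its justification is the
      -- required instance of `F`.
      base-holds : ∀ {m} {Γ : Ctx m} (σ : Fin (suc (suc n)) → Term SeqL m) →
                   Env Γ (λ i → σ (fs (fs i))) xs → Γ ⊩ subF (traceT ◂ σ) base
      base-holds {m} σ h = ∀I (⇒I (∈-setT⁻ pairT L
          (∈-congʳ (conv (cong (renT fs traceT ≐_) (renT-closed fs (setT pairT L))) (≐refl _))
            (to∈ σ' (eT ⊢T v 0) (v 1) hyp₀))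
          λ where
            (zero , u) i → intro∘ (J i) σ' baseArgs (λ i → weaken (weaken (Num-shift (h i)))) (⊢T-injʳ hyp₀)
            (suc j , u) i → ⊥E (⊢T-≢e (≐sym (⊢T-injˡ hyp₀)))))
        where
        σ' : Fin (suc (suc (suc (suc n)))) → Term SeqL (suc m)
        σ' = liftS (traceT ◂ σ)

      -- Now the entries at 0 cannot match, and the entry that justifies the matched one provides
      -- the witness.
      step-holds : ∀ {m} {Γ : Ctx m} (σ : Fin (suc (suc n)) → Term SeqL m) →
                   Env Γ (λ i → σ (fs (fs i))) xs → Γ ⊩ subF (traceT ◂ σ) step
      step-holds {m} {Γ} σ h = ∀I (∀I (⇒I (∈-setT⁻ pairT L
          (∈-congʳ traceT-shift² (to∈ σ' ((v 1 ⊢T eT) ⊢T v 0) (v 2) hyp₀))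
          λ where
            (zero , u) i → ⊥E (⊢T-≢e (⊢T-injˡ hyp₀))
            (suc j , u) i → let w , i' , R = J i in
              ∃I σ' back (closed (num w)) (∧I
                (from∈ (closed (num w) ◂ σ') (v 2 ⊢T v 0) (v 3)
                  (∈-congʳ (≐sym traceT-shift²)
                    (∈-congˡ (⊢T-cong (≐sym (⊢T-injˡ (⊢T-injˡ hyp₀))) (≐refl _)) (∈-setT⁺ pairT i'))))
                (intro∘ R (closed (num w) ◂ σ') stepArgs
                  (λ { fz → ⊢T-injˡ (⊢T-injˡ hyp₀)
                     ; (fs fz) → ≐refl _
                     ; (fs (fs i)) → weaken (weaken (Num-shift (Num-shift (h i)))) })
                  (⊢T-injʳ hyp₀))))))
        where
        σ' : Fin (suc (suc (suc (suc (suc n))))) → Term SeqL (suc (suc m))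
        σ' = liftS (liftS (traceT ◂ σ))

        traceT-shift² : ∀ {Δ : Ctx (suc (suc m))} → Δ ⊩ renT fs (renT fs traceT) ≐ traceT
        traceT-shift² = conv (cong (renT fs (renT fs traceT) ≐_)
          (trans (cong (renT fs) (renT-closed fs (setT pairT L))) (renT-closed fs (setT pairT L)))) (≐refl _)

      prec-rep : ∀ {k y} → (k , y) ∈ L → Rep precF (k ∷ xs) y
      prec-rep {k} i .elim σ h d = ∃E d (Num-unshift fs
        (unique k i (liftS σ) (λ i → weaken (Num-shift (h (fs i))))
          (∧E₁ (∧E₂ hyp₀)) (∧E₂ (∧E₂ hyp₀)) (renT fs (σ fz))
          (∈-congˡ (⊢T-cong (weaken (Num-shift (h fz))) (≐refl _))
            (to∈ (liftS σ) (v 2 ⊢T v 1) (v 0) (∧E₁ hyp₀)))))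
      prec-rep i .intro σ h d = ∃I σ trace traceT (∧I
        (from∈ (traceT ◂ σ) (v 2 ⊢T v 1) (v 0)
          (∈-congˡ (≐sym (⊢T-cong (h fz) d)) (∈-setT⁺ pairT i)))
        (∧I (base-holds σ (h ∘ fs)) (step-holds σ (h ∘ fs))))

-- miniF has variables y, xs. The set s of search contains 0 and is closed under successor away from y,
-- so it must contain the true minimum k; and y is its only element at which F takes the value 0.
module Mini {n} (F : Formula SeqL (suc (suc n))) where

  goalArgs : Fin (suc (suc n)) → Term SeqL (suc (suc n))
  goalArgs = eT ◂ v 1 ◂ λ i → var (fs (fs i))

  pointArgs : Fin (suc (suc n)) → Term SeqL (suc (suc (suc n)))
  pointArgs = eT ◂ v 0 ◂ λ i → var (fs (fs (fs i)))

  next' : Formula SeqL (suc (suc (suc n)))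
  next' = v 0 ∈ˢ v 1 ⇒ (¬' (v 0 ≐ v 2)) ⇒ (v 0 ⊢T eT) ∈ˢ v 1

  stop' : Formula SeqL (suc (suc (suc n)))
  stop' = v 0 ∈ˢ v 1 ⇒ subF pointArgs F ⇒ v 0 ≐ v 2

  search : Formula SeqL (suc (suc n))
  search = (eT ∈ˢ v 0) ∧' (subF goalArgs F ∧' (∀' next' ∧' ∀' stop'))

  miniF : Formula SeqL (suc n)
  miniF = ∃' search

  module _ {xs : Vec ℕ n} {k} (R : Rep F (k ∷ xs) 0)
           (R< : ∀ j → j < k → Σ ℕ λ u → Rep F (j ∷ xs) (suc u)) where

    -- Metainduction on `j`. Below `k` the value of `F` at `j` is a successor, whereas `search`
    -- demands 0 at `y`; so `j` differs from `y`, and closure puts its successor into the set.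
    climb : ∀ {m} {Γ : Ctx m} (σ : Fin (suc (suc n)) → Term SeqL m) →
            Env Γ (λ i → σ (fs (fs i))) xs → Γ ⊩ subF σ search →
            ∀ j → j ≤ k → Γ ⊩ closed (num j) ∈ˢ σ fz
    climb σ h d zero    _ = to∈ σ eT (v 0) (∧E₁ d)
    climb σ h d (suc j) p = to∈ σ' (v 0 ⊢T eT) (v 1)
      (⇒E (⇒E (inst σ next' (∧E₁ (∧E₂ (∧E₂ d))) (closed (num j)))
            (from∈ σ' (v 0) (v 1) (climb σ h d j (<⇒≤ p))))
          (⇒I (Num-0≢suc (≐refl _) (elim∘ (proj₂ (R< j p)) σ goalArgs
            (λ { fz → ≐sym hyp₀ ; (fs i) → weaken (h i) })
            (weaken (∧E₁ (∧E₂ d)))))))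
      where
      σ' = closed (num j) ◂ σ

    -- The numerals from 0 to `k` inclusive: `next'` exempts only `k`, so the successor of each
    -- smaller number must be present.
    rangeT : ∀ {m} → Term SeqL m
    rangeT = closed (setT num (upTo (suc k)))

    rangeT-shift : ∀ {m} {Γ : Ctx (suc m)} → Γ ⊩ renT fs (rangeT {m}) ≐ rangeT
    rangeT-shift {m} = conv (cong (renT fs (rangeT {m}) ≐_) (renT-closed fs (setT num (upTo (suc k))))) (≐refl _)

    mini-rep : Rep miniF xs k
    -- By `climb` the set contains `k`, where `F` takes the value 0, so `stop'` at `k` gives
    -- `k = y`.
    mini-rep .elim σ h d = ∃E d (Num-unshift fs (≐sym
      (⇒E (⇒E (inst (liftS σ) stop' (∧E₂ (∧E₂ (∧E₂ hyp₀))) (closed (num k)))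
            (from∈ (closed (num k) ◂ liftS σ) (v 0) (v 1)
              (climb (liftS σ) (λ i → weaken (Num-shift (h i))) hyp₀ k ≤-refl)))
          (intro∘ R (closed (num k) ◂ liftS σ) pointArgs
            (λ { fz → ≐refl _ ; (fs i) → weaken (Num-shift (h i)) }) (≐refl _)))))
    mini-rep .intro {m} {Γ} σ h d = ∃I σ search rangeT (∧I
        (from∈ (rangeT ◂ σ) eT (v 0) (∈-setT⁺ num (∈-upTo⁺ (s≤s z≤n))))
        (∧I (intro∘ R (rangeT ◂ σ) goalArgs (λ { fz → d ; (fs i) → h i }) (≐refl _))
        (∧I next-holds stop-holds)))
      where
      σ' : Fin (suc (suc (suc n))) → Term SeqL (suc m)
      σ' = liftS (rangeT ◂ σ)

      next-holds : Γ ⊩ subF (rangeT ◂ σ) (∀' next')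
      next-holds = ∀I (⇒I (⇒I (∈-setT⁻ num (upTo (suc k))
        (∈-congʳ rangeT-shift (to∈ σ' (v 0) (v 1) hyp₁))
        λ j i → case j ≟ k of λ where
          (yes refl) → ⊥E (⇒E hyp₁ (≐trans hyp₀ (≐sym (weaken (weaken (weaken (Num-shift d)))))))
          (no j≢k) → from∈ σ' (v 0 ⊢T eT) (v 1) (∈-congʳ (≐sym rangeT-shift)
            (∈-congˡ (⊢T-cong (≐sym hyp₀) (≐refl _))
              (∈-setT⁺ num (∈-upTo⁺ (s≤s (≤∧≢⇒< (≤-pred (∈-upTo⁻ i)) j≢k)))))))))

      stop-holds : Γ ⊩ subF (rangeT ◂ σ) (∀' stop')
      stop-holds = ∀I (⇒I (⇒I (∈-setT⁻ num (upTo (suc k))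
        (∈-congʳ rangeT-shift (to∈ σ' (v 0) (v 1) hyp₁))
        λ j i → case j ≟ k of λ where
          (yes refl) → ≐trans hyp₀ (≐sym (weaken (weaken (weaken (Num-shift d)))))
          (no j≢k) → ⊥E (Num-0≢suc (≐refl _)
            (elim∘ (proj₂ (R< j (≤∧≢⇒< (≤-pred (∈-upTo⁻ i)) j≢k))) σ' pointArgs
              (λ { fz → hyp₀ ; (fs i) → weaken (weaken (weaken (Num-shift (h i)))) })
              hyp₁)))))

open Prec using (precF; prec-rep; Trace)
open Mini using (miniF; mini-rep)

-- Formulas representing μ-recursive functions

Φ  : ∀ {n} → μR n → Formula SeqL (suc n)
Φs : ∀ {n m} → Vec (μR n) m → Vec (Formula SeqL (suc n)) m
Φ Z           = v 0 ≐ eT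
Φ S           = v 0 ≐ v 1 ⊢T eT
Φ (P i)       = v 0 ≐ var (fs i)
-- `f` reads the intermediate values, which come first; the block of original arguments behind them
-- remains in scope for the formulas of `gs`.
Φ {n} (comp f gs) = exComp (Φs gs) (subF (v 0 ◂ λ i → var (fs (i ↑ˡ n))) (Φ f))
Φ (prec f g)  = precF (Φ f) (Φ g)
Φ (mini f)    = miniF (Φ f)
Φs []       = []
Φs (g ∷ gs) = Φ g ∷ Φs gs

Traced : ∀ {n} → μR n → μR (suc (suc n)) → Vec ℕ n → ℕ → ℕ → Set
Traced f g xs k y = Σ (List (ℕ × ℕ)) λ L → (k , y) ∈ L × Trace (Φ f) (Φ g) xs L

-- Induction on the evaluation derivation, so only values that are actually reached get represented
-- and partiality never enters.
rep    : ∀ {n} {h : μR n} {xs y} → h [ xs ]↓ y → Rep (Φ h) xs y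
reps   : ∀ {n m} {gs : Vec (μR n) m} {xs ys F y} → gs [ xs ]↓* ys →
         Rep F (ys ++ xs) y → Rep (exComp (Φs gs) F) xs y
-- The evaluation runs through the values at 0, ..., `k`; listed, they form the set that `precF`
-- asserts to exist.
traced : ∀ {n} {f : μR n} {g k xs y} → prec f g [ k ∷ xs ]↓ y → Traced f g xs k y

rep evZ .elim σ h d      = d
rep evZ .intro σ h d     = d
rep evS .elim σ h d      = ≐trans d (⊢T-cong (h fz) (≐refl _))
rep evS .intro σ h d     = ≐trans d (≐sym (⊢T-cong (h fz) (≐refl _)))
rep (evP {i = i}) .elim σ h d  = ≐trans d (h i)
rep (evP {i = i}) .intro σ h d = ≐trans d (≐sym (h i))
rep (evComp {f = f} {xs = xs} {ys} ds d) = reps ds λ where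
    .elim σ h → elim∘ (rep d) σ τ (λ i → subst (Num _ _) (lookup-++ˡ ys xs i) (h (i ↑ˡ _)))
    .intro σ h → intro∘ (rep d) σ τ (λ i → subst (Num _ _) (lookup-++ˡ ys xs i) (h (i ↑ˡ _)))
  where
  τ = v 0 ◂ λ i → var (fs (i ↑ˡ _))
rep {h = prec f g} (evPrec0 d)    = let L , i , J = traced (evPrec0 {g = g} d) in prec-rep (Φ f) (Φ g) _ J i
rep {h = prec f g} (evPrecS d d') = let L , i , J = traced (evPrecS d d') in prec-rep (Φ f) (Φ g) _ J i
rep {h = mini f} (evMini d h)     = mini-rep (Φ f) (rep d) λ j p → proj₁ (h j p) , rep (proj₂ (h j p))

reps ev[]                            R = R
reps (ev∷ {xs = xs} {ys = ys} d ds) R =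
  reps ds (bind-rep (_ ↑ʳ_) _ _ (rep d) R (lookup-++ʳ ys xs))

traced (evPrec0 d) = _ ,, ε , here refl , λ { (here refl) → rep d }
traced {f = f} {g} {xs = xs} (evPrecS {k = k} {y = y} d d') =
  let L , i , J = traced d in (suc k , y) ,, L , here refl , grow L i J
  where
  -- Old entries stay justified in the longer list, since their predecessors are still in it;
  -- entries at 0 refer to none.
  grow : ∀ L → (k , _) ∈ L → Trace (Φ f) (Φ g) xs L → Trace (Φ f) (Φ g) xs ((suc k , y) ,, L)
  grow L i J (here refl) = _ , there i , rep d'
  grow L i J {zero} (there i') = J i'
  grow L i J {suc j} (there i') = let w , i'' , R = J i' in w , there i'' , R

-- Primitive recursive coding

const : ∀ {n} → ℕ → μR n
const zero    = comp Z []
const (suc k) = comp S (const k ∷ [])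

const-↓ : ∀ k {n} {xs : Vec ℕ n} → const k [ xs ]↓ k
const-↓ zero    = evComp ev[] evZ
const-↓ (suc k) = evComp (ev∷ (const-↓ k) ev[]) evS

double : μR 1
double = prec Z (comp S (comp S (P (fs fz) ∷ []) ∷ []))

double-↓ : ∀ k → double [ k ∷ [] ]↓ (2 * k)
double-↓ zero    = evPrec0 evZ
double-↓ (suc k) = subst (double [ suc k ∷ [] ]↓_) (sym (*-suc 2 k))
  (evPrecS (double-↓ k) (evComp (ev∷ (evComp (ev∷ evP ev[]) evS) ev[]) evS))

-- `pair a b` is `suc (2 * b)` doubled `a` times.
pairμ : μR 2
pairμ = prec (comp S (double ∷ [])) (comp double (P (fs fz) ∷ []))

pairμ-↓ : ∀ a b → pairμ [ a ∷ b ∷ [] ]↓ pair a b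
pairμ-↓ zero b    = subst (pairμ [ 0 ∷ b ∷ [] ]↓_) (sym (*-identityˡ (suc (2 * b))))
  (evPrec0 (evComp (ev∷ (double-↓ b) ev[]) evS))
pairμ-↓ (suc a) b = subst (pairμ [ suc a ∷ b ∷ [] ]↓_) (sym (*-assoc 2 (2 ^ a) (suc (2 * b))))
  (evPrecS (pairμ-↓ a b) (evComp (ev∷ evP ev[]) (double-↓ _)))

pairOf : ∀ {n} → μR n → μR n → μR n
pairOf f g = comp pairμ (f ∷ g ∷ [])

pairOf-↓ : ∀ {n} {f g : μR n} {xs a b} → f [ xs ]↓ a → g [ xs ]↓ b → pairOf f g [ xs ]↓ pair a b
pairOf-↓ d d' = evComp (ev∷ d (ev∷ d' ev[])) (pairμ-↓ _ _)

-- The step assembles the code of `x ⊢T eT` from that of `x`, which is the recursive value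
-- `P (fs fz)`. Numerals contain no variables, so their codes are the same in every scope.
numCode : μR 1
numCode = prec (pairOf (const 1) (pairOf (const 0) (const 0)))
  (pairOf (const 1) (pairOf (const 1) (comp S (pairOf (P (fs fz))
    (comp S (pairOf (pairOf (const 1) (pairOf (const 0) (const 0))) (const 0) ∷ [])) ∷ []))))

numCode-↓ : ∀ {n} k → numCode [ k ∷ [] ]↓ codeT {n} (closed (num k))
numCode-↓ zero    = evPrec0 (pairOf-↓ (const-↓ 1) (pairOf-↓ (const-↓ 0) (const-↓ 0)))
numCode-↓ {n} (suc k) = evPrecS (numCode-↓ {n} k)
  (pairOf-↓ (const-↓ 1) (pairOf-↓ (const-↓ 1) (evComp (ev∷ (pairOf-↓ evP
    (evComp (ev∷ (pairOf-↓ (pairOf-↓ (const-↓ 1) (pairOf-↓ (const-↓ 0) (const-↓ 0))) (const-↓ 0)) ev[]) evS))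
    ev[]) evS)))

diagonal : Formula SeqL 1 → Formula SeqL 0
diagonal φ = ∀' (v 0 ≐ closed (num (code φ)) ⇒ φ)

-- `code φ` enters the code of `diagonal φ` twice: verbatim, as `P fz`, and through the code of its
-- numeral. The pair of zeros codes variable 0.
diagCode : μR 1
diagCode = pairOf (const 3) (pairOf (const 2) (pairOf
  (pairOf (const 1) (pairOf (pairOf (const 0) (const 0)) numCode)) (P fz)))

diagCode-↓ : ∀ φ → diagCode [ code φ ∷ [] ]↓ code (diagonal φ)
diagCode-↓ φ = pairOf-↓ (const-↓ 3) (pairOf-↓ (const-↓ 2) (pairOf-↓
  (pairOf-↓ (const-↓ 1) (pairOf-↓ (pairOf-↓ (const-↓ 0) (const-↓ 0)) (numCode-↓ {1} (code φ)))) evP))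

-- Injectivity of the coding

-- Factors of 2 are cancelled in parallel; if one exponent runs out first, an odd number would equal
-- an even one.
pair-injective : ∀ a b c d → pair a b ≡ pair c d → a ≡ c × b ≡ d
pair-injective zero b zero d eq = refl , *-cancelˡ-≡ b d 2 (suc-injective
  (trans (sym (*-identityˡ _)) (trans eq (*-identityˡ _))))
pair-injective zero b (suc c) d eq = ⊥-elim (even≢odd (2 ^ c * suc (2 * d)) b
  (trans (sym (*-assoc 2 (2 ^ c) _)) (trans (sym eq) (*-identityˡ _))))
pair-injective (suc a) b zero d eq = ⊥-elim (even≢odd (2 ^ a * suc (2 * b)) d
  (trans (sym (*-assoc 2 (2 ^ a) _)) (trans eq (*-identityˡ _))))
pair-injective (suc a) b (suc c) d eq =
  let p , q = pair-injective a b c d (*-cancelˡ-≡ _ _ 2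
        (trans (sym (*-assoc 2 (2 ^ a) _)) (trans eq (*-assoc 2 (2 ^ c) _))))
  in cong suc p , q

codeFun-injective : ∀ f g → codeFun f ≡ codeFun g → f ≡ g
codeFun-injective e    e    _ = refl
codeFun-injective tu   tu   _ = refl
codeFun-injective circ circ _ = refl

codeT-injective  : ∀ {n} (s t : Term SeqL n) → codeT s ≡ codeT t → s ≡ t
codeTs-injective : ∀ {n k} (ss ts : Vec (Term SeqL n) k) → codeTs ss ≡ codeTs ts → ss ≡ ts
codeT-injective (var i) (var j) eq =
  cong var (toℕ-injective (proj₂ (pair-injective 0 (toℕ i) 0 (toℕ j) eq)))
codeT-injective (var i) (app g us) eq
  with () ← proj₁ (pair-injective 0 (toℕ i) 1 (pair (codeFun g) (codeTs us)) eq)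
codeT-injective (app f ts) (var j) eq
  with () ← proj₁ (pair-injective 1 (pair (codeFun f) (codeTs ts)) 0 (toℕ j) eq)
codeT-injective (app f ts) (app g us) eq
  with pair-injective (codeFun f) (codeTs ts) (codeFun g) (codeTs us)
         (proj₂ (pair-injective 1 (pair (codeFun f) (codeTs ts)) 1 (pair (codeFun g) (codeTs us)) eq))
... | p , q with codeFun-injective f g p
... | refl = cong (app f) (codeTs-injective ts us q)
codeTs-injective []       []       eq = refl
codeTs-injective (s ∷ ss) (t ∷ ts) eq =
  let p , q = pair-injective (codeT s) _ (codeT t) _ (suc-injective eq)
  in cong₂ _∷_ (codeT-injective s t p) (codeTs-injective ss ts q)

-- `TheoremCodes` speaks of some provable sentence with a given code; injectivity identifies it with
-- the diagonal sentence. Since every code is a pair of `tag` and `body`, one use of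
-- `pair-injective` reduces the proof to formulas with the same outermost constructor.
code-injective : ∀ {n} (φ ψ : Formula SeqL n) → code φ ≡ code ψ → φ ≡ ψ
code-injective φ ψ eq = go φ ψ (pair-injective (tag φ) (body φ) (tag ψ) (body ψ)
    (trans (sym (split φ)) (trans eq (split ψ))))
  where
  tag body : ∀ {n} → Formula SeqL n → ℕ
  tag ⊥'      = 0
  tag (_ ≐ _) = 1
  tag (_ ⇒ _) = 2
  tag (∀' _)  = 3
  body ⊥'      = 0
  body (s ≐ t) = pair (codeT s) (codeT t)
  body (φ ⇒ ψ) = pair (code φ) (code ψ)
  body (∀' φ)  = code φ

  split : ∀ {n} (φ : Formula SeqL n) → code φ ≡ pair (tag φ) (body φ)
  split ⊥'      = refl
  split (_ ≐ _) = refl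
  split (_ ⇒ _) = refl
  split (∀' _)  = refl

  go : ∀ {n} (φ ψ : Formula SeqL n) → tag φ ≡ tag ψ × body φ ≡ body ψ → φ ≡ ψ
  go ⊥'      ⊥'        _       = refl
  go (s ≐ t) (s' ≐ t') (_ , q) =
    let p , r = pair-injective (codeT s) _ (codeT s') _ q
    in cong₂ _≐_ (codeT-injective s s' p) (codeT-injective t t' r)
  go (φ ⇒ ψ) (φ' ⇒ ψ') (_ , q) =
    let p , r = pair-injective (code φ) _ (code φ') _ q
    in cong₂ _⇒_ (code-injective φ φ' p) (code-injective ψ ψ' r)
  go (∀' φ)  (∀' ψ)    (_ , q) = cong ∀' (code-injective φ ψ q)

-- H(y, x) represents the function deciding whether the diagonalisation of the formula coded by x is
-- provable; the sentence diagonal φ₀ says that this value is 0 for diagonal φ₀ itself.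
module _ (H : Formula SeqL 2) where

  φ₀ : Formula SeqL 1
  φ₀ = subF (eT ◂ var) H

  -- Instantiated at its own code, the diagonal sentence says that the value is 0, while `elim`
  -- forces it to be 1.
  refutable : Rep H (code φ₀ ∷ []) 1 → ε ⊩ (¬' diagonal φ₀)
  refutable R = ⇒I (Num-0≢suc {t = eT} {k = 0} (≐refl _) (elim∘ R (sub0 c) (eT ◂ var) (λ { fz → ≐refl _ })
      (⇒E (∀E hyp₀ c) (conv (cong (c ≐_) (sym (subT-closed (sub0 c) (num (code φ₀))))) (≐refl _)))))
    where
    c = closed (num (code φ₀))

  -- The premise that `x` equals the numeral is exactly the `Env` that `intro` asks for.
  provable : Rep H (code φ₀ ∷ []) 0 → ε ⊩ diagonal φ₀
  provable R = ∀I (⇒I (intro R (eT ◂ var) (λ { fz → hyp₀ }) (≐refl _)))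

  diagonalise : ∀ {f U} → (∀ φ → SeqAx ⊢ φ → U ⊢ φ) → ¬ (U ⊢ ⊥') →
    (∀ k → (TheoremCodes U k → f [ k ∷ [] ]↓ 1) × (¬ TheoremCodes U k → f [ k ∷ [] ]↓ 0)) →
    (∀ φ {y} → f [ code (diagonal φ) ∷ [] ]↓ y → Rep H (code φ ∷ []) y) → ⊥
  diagonalise {U = U} Seq⊆U consistent decides R = notUnprovable λ where
      thm@(ψ , eq , d) → consistent (⇒E
        (Seq⊆U _ (refutable (R φ₀ (proj₁ (decides (code (diagonal φ₀))) thm))))
        (subst (U ⊢_) (code-injective ψ (diagonal φ₀) eq) d))
    where
    -- Constructively there is no case distinction on provability. Unprovability is refuted first,
    -- since it makes the value 0 and hence the sentence provable; a proof is then refuted in turn.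
    notUnprovable : ¬ ¬ TheoremCodes U (code (diagonal φ₀))
    notUnprovable ¬thm = ¬thm (diagonal φ₀ , refl ,
      Seq⊆U _ (provable (R φ₀ (proj₂ (decides (code (diagonal φ₀))) ¬thm))))

essentiallyUndecidable : EssentiallyUndecidable SeqAx
essentiallyUndecidable U Seq⊆U consistent (f , decides) =
  diagonalise (Φ (comp f (diagCode ∷ []))) Seq⊆U consistent decides
    (λ φ d → rep (evComp (ev∷ (diagCode-↓ φ) ev[]) d))

theorem4 : Sequential SeqAx × EssentiallyUndecidable SeqAx
theorem4 = sequential , essentiallyUndecidable
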